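{- Let $k,n$ be positive integers with $k\leqslant n$ and let $C\in\mathrm{Conf}([n]^k_<)$ be a shelling order. Then its promotion $\partial_D C$ is a shelling order.
   Context: $[n]:=\{1,\ldots,n\}$; $[n]^k_<$ denotes the set of $k$-element subsets of $[n]$. $\mathrm{Conf}([n]^k_<)$ is the set of tuples $C=(C_1,\ldots,C_h)$, $h\geqslant1$, of pairwise distinct elements of $[n]^k_<$. $C$ is a shelling order if for all $i<j$ in $[h]$ there exists $z<j$ with $|C_z\cap C_j|=k-1$ and $C_i\cap C_j\subseteq C_z\cap C_j$. The dual graph $D(C)$ is the graph on vertex set $[h]$ with $\{i,j\}$ an edge iff $|C_i\cap C_j|=k-1$. For a graph $G$ on vertex set $[h]$, its track $T_G=\{v_1,\ldots,v_r\}$ is defined by $v_1=1$ and, for $i\geqslant 2$, $v_i=\min\{j\in[h]: j>v_{i-1},\ \{v_{i-1},j\}\text{ an edge}\}$ if this minimum exists, otherwise $r=i-1$. The promotion of $G$ is the permutation $\partial_G\in S_h$ with $\partial_G(i)=i-1$ for $i\notin T_G$, $\partial_G(v_j)=v_{j+1}-1$ for $j\in[r-1]$, and $\partial_G(v_r)=h$. For $\sigma\in S_h$ set $\sigma C:=(C_{\sigma^{ -1}(1)},\ldots,C_{\sigma^{ -1}(h)})$. The promotion of $C$ is $\partial_D C:=\partial_{D(C)}C$. -}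

module Defs where

open import Data.Fin.Base using (Fin; zero; suc; toℕ; fromℕ; pred; punchOut; _<_; _≤_)
open import Data.Fin.Induction using (<-wellFounded)
open import Data.Fin.Permutation using (Permutation′; permutation; flip; _⟨$⟩ˡ_)
open import Data.Fin.Properties
  using (_≟_; _<?_; _≤?_; <-cmp; ≤-antisym; any?; all?; toℕ-fromℕ;
         toℕ-injective; toℕ≤pred[n]; toℕ-inject₁; punchOut-injective; injective⇒≤)
open import Data.Fin.Subset using (Subset; _∩_; _⊆_; ∣_∣)
open import Data.Fin.Subset.Properties using (∩-comm; ∩-idem)
open import Data.Nat.Base as ℕ using (ℕ; NonZero)
import Data.Nat.Properties as ℕ
open import Data.Product.Base using (∃; ∃-syntax; _×_; _,_; proj₁; proj₂)
open import Function.Base using (_∘_)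
open import Function.Bundles using (module Injection)
open import Function.Definitions using (Injective)
open import Function.Properties.Inverse using (↔⇒↣)
open import Induction.WellFounded using (Acc; acc)
open import Level using (0ℓ)
open import Relation.Binary.Core using (Rel)
open import Relation.Binary.Definitions using (Symmetric; Decidable; tri<; tri≈; tri>)
open import Relation.Binary.PropositionalEquality
  using (_≡_; _≢_; refl; sym; trans; cong; subst)
open import Relation.Nullary using (¬_; Dec; yes; no; contradiction)
open import Relation.Nullary.Decidable using (_×-dec_; _→-dec_; map′)

-- Simple graphs on [h], with vertices 1, …, h written as 0, …, h-1.
-- A graph on a finite set is given by a set of edges, so adjacency is decidable.
record Graph (h : ℕ) : Set₁ where
  field
    Adj      : Rel (Fin h) 0ℓ
    symm     : Symmetric Adj
    loopless : ∀ {i} → ¬ Adj i i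
    adj?     : Decidable Adj

module Promotion {m : ℕ} (G : Graph (ℕ.suc m)) where
  open Graph G

  V : Set
  V = Fin (ℕ.suc m)

  -- j = min { l > i : {i , l} an edge }
  Next : V → V → Set
  Next i j = i < j × Adj i j × (∀ l → i < l → Adj i l → j ≤ l)

  -- InTrack v says that v ∈ T_G = { v₁ , … , v_r }.
  data InTrack : V → Set where
    start : InTrack zero
    step  : ∀ {i j} → InTrack i → Next i j → InTrack j

  -- Promotes i p says that p is the value of the promotion at i.  The truncated
  -- predecessor is only ever applied to nonzero vertices, as zero is in the
  -- track and Next i j forces j to be nonzero.
  data Promotes (i p : V) : Set where
    off  : ¬ InTrack i → p ≡ pred i → Promotes i p
    move : ∀ {j} → InTrack i → Next i j → p ≡ pred j → Promotes i p
    end  : InTrack i → ¬ ∃ (Next i) → p ≡ fromℕ m → Promotes i p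

  next? : Decidable Next
  next? i j = (i <? j) ×-dec adj? i j ×-dec
    all? (λ l → (i <? l) →-dec (adj? i l →-dec (j ≤? l)))

  inTrack-acc : ∀ i → Acc _<_ i → Dec (InTrack i)
  inTrack-acc zero    _        = yes start
  inTrack-acc (suc i) (acc rs) =
    map′ (λ (_ , t , nx) → step t nx) (λ { (step t nx) → _ , t , nx }) (any? previous?)
    where
    previous? : ∀ l → Dec (InTrack l × Next l (suc i))
    previous? l with next? l (suc i)
    ... | no ¬nx = no (¬nx ∘ proj₂)
    ... | yes nx = map′ (_, nx) proj₁ (inTrack-acc l (rs (proj₁ nx)))

  inTrack? : ∀ i → Dec (InTrack i)
  inTrack? i = inTrack-acc i (<-wellFounded i)

  promote : ∀ i → ∃ (Promotes i)
  promote i with inTrack? i | any? (next? i)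
  ... | no ¬t | _            = _ , off ¬t refl
  ... | yes t | yes (_ , nx) = _ , move t nx refl
  ... | yes t | no ¬nx       = _ , end t ¬nx refl

  next-unique : ∀ {i j j′} → Next i j → Next i j′ → j ≡ j′
  next-unique (lt , a , least) (lt′ , a′ , least′) =
    ≤-antisym (least _ lt′ a′) (least′ _ lt a)

  track-chain : ∀ {i i′} → InTrack i → InTrack i′ → i < i′ → ∃[ j ] Next i j × j ≤ i′
  track-chain {i} t (step {i″} t″ nx) i<i′ with <-cmp i i″
  ... | tri< i<i″ _ _ =
    let j , nx′ , j≤i″ = track-chain t t″ i<i″
    in j , nx′ , ℕ.≤-trans j≤i″ (ℕ.<⇒≤ (proj₁ nx))
  ... | tri≈ _ refl _ = _ , nx , ℕ.≤-refl
  ... | tri> _ _ i″<i with track-chain t″ t i″<i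
  ...   | j , nx′ , j≤i rewrite next-unique nx′ nx = contradiction j≤i (ℕ.<⇒≱ i<i′)

  next-injective : ∀ {i i′ j} → InTrack i → InTrack i′ → Next i j → Next i′ j → i ≡ i′
  next-injective {i} {i′} t t′ nx nx′ with <-cmp i i′
  ... | tri≈ _ eq _ = eq
  ... | tri< lt _ _ with track-chain t t′ lt
  ...   | j , nx″ , j≤i′ rewrite next-unique nx″ nx = contradiction j≤i′ (ℕ.<⇒≱ (proj₁ nx′))
  next-injective {i} {i′} t t′ nx nx′ | tri> _ _ gt with track-chain t′ t gt
  ...   | j , nx″ , j≤i rewrite next-unique nx″ nx′ = contradiction j≤i (ℕ.<⇒≱ (proj₁ nx))

  end-unique : ∀ {i i′} → InTrack i → InTrack i′ → ¬ ∃ (Next i) → ¬ ∃ (Next i′) → i ≡ i′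
  end-unique {i} {i′} t t′ ¬nx ¬nx′ with <-cmp i i′
  ... | tri≈ _ eq _ = eq
  ... | tri< lt _ _ = let j , nx , _ = track-chain t t′ lt in contradiction (j , nx) ¬nx
  ... | tri> _ _ gt = let j , nx , _ = track-chain t′ t gt in contradiction (j , nx) ¬nx′

  pred-injective : ∀ {i j : V} → i ≢ zero → j ≢ zero → pred i ≡ pred j → i ≡ j
  pred-injective {zero}          i≢0 _ _  = contradiction refl i≢0
  pred-injective {suc _} {zero}  _ j≢0 _  = contradiction refl j≢0
  pred-injective {suc i} {suc j} _ _   eq = toℕ-injective (cong ℕ.suc
    (trans (sym (toℕ-inject₁ i)) (trans (cong toℕ eq) (toℕ-inject₁ j))))

  pred≢last : ∀ {i : V} → i ≢ zero → pred i ≢ fromℕ m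
  pred≢last {zero}  i≢0 _  = i≢0 refl
  pred≢last {suc i} _   eq = ℕ.<⇒≢ (toℕ≤pred[n] (suc i))
    (trans (sym (toℕ-inject₁ i)) (trans (cong toℕ eq) (toℕ-fromℕ m)))

  off≢0 : ∀ {i} → ¬ InTrack i → i ≢ zero
  off≢0 ¬t refl = ¬t start

  next≢0 : ∀ {i j} → Next i j → j ≢ zero
  next≢0 (() , _) refl

  promotes-injective : ∀ {i i′ p} → Promotes i p → Promotes i′ p → i ≡ i′
  promotes-injective (off a e) (off b f) =
    pred-injective (off≢0 a) (off≢0 b) (trans (sym e) f)
  promotes-injective (off a e) (move t nx f)
    with refl ← pred-injective (off≢0 a) (next≢0 nx) (trans (sym e) f) =
    contradiction (step t nx) a
  promotes-injective (off a e) (end _ _ f) =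
    contradiction (trans (sym e) f) (pred≢last (off≢0 a))
  promotes-injective (move t nx e) (off b f)
    with refl ← pred-injective (off≢0 b) (next≢0 nx) (trans (sym f) e) =
    contradiction (step t nx) b
  promotes-injective (move t nx e) (move t′ nx′ f)
    with refl ← pred-injective (next≢0 nx) (next≢0 nx′) (trans (sym e) f) =
    next-injective t t′ nx nx′
  promotes-injective (move _ nx e) (end _ _ f) =
    contradiction (trans (sym e) f) (pred≢last (next≢0 nx))
  promotes-injective (end _ _ e) (off b f) =
    contradiction (trans (sym f) e) (pred≢last (off≢0 b))
  promotes-injective (end _ _ e) (move _ nx f) =
    contradiction (trans (sym f) e) (pred≢last (next≢0 nx))
  promotes-injective (end t ¬nx _) (end t′ ¬nx′ _) = end-unique t t′ ¬nx ¬nx′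

  to : V → V
  to i = proj₁ (promote i)

  to-injective : Injective _≡_ _≡_ to
  to-injective {i} {i′} eq =
    promotes-injective (subst (Promotes i) eq (proj₂ (promote i))) (proj₂ (promote i′))

  to-surjective : ∀ p → ∃[ i ] to i ≡ p
  to-surjective p with any? (λ i → to i ≟ p)
  ... | yes hit = hit
  ... | no miss = contradiction
    (injective⇒≤ {f = λ i → punchOut (p≢to i)}
      (λ {i} {i′} eq → to-injective (punchOut-injective (p≢to i) (p≢to i′) eq)))
    ℕ.1+n≰n
    where
    p≢to : ∀ i → p ≢ to i
    p≢to i eq = miss (i , sym eq)

  ∂ : Permutation′ (ℕ.suc m)
  ∂ = permutation to (proj₁ ∘ to-surjective) (proj₂ ∘ to-surjective)
        (λ i → to-injective (proj₂ (to-surjective (to i))))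

open Promotion public using (∂)

-- Tuples of length h; the condition h ≥ 1 appears below as h = suc m.
record Conf (n k h : ℕ) : Set where
  field
    facet    : Fin h → Subset n
    size     : ∀ i → ∣ facet i ∣ ≡ k
    distinct : Injective _≡_ _≡_ facet

open Conf public

IsShellingOrder : ∀ {n k h} → Conf n k h → Set
IsShellingOrder {k = k} C = ∀ i j → i < j →
  ∃[ z ] z < j
       × ∣ facet C z ∩ facet C j ∣ ≡ k ℕ.∸ 1
       × facet C i ∩ facet C j ⊆ facet C z ∩ facet C j

-- Positivity of k is what makes this graph loopless, as ∣ C i ∩ C i ∣ = k.
dualGraph : ∀ {n k h} .{{_ : NonZero k}} → Conf n k h → Graph h
dualGraph {k = k} C = record
  { Adj      = λ i j → ∣ facet C i ∩ facet C j ∣ ≡ k ℕ.∸ 1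
  ; symm     = λ {i} {j} e → trans (cong ∣_∣ (∩-comm (facet C j) (facet C i))) e
  ; loopless = λ {i} e → ℕ.1+n≢n (trans (ℕ.suc-pred k)
      (trans (sym (size C i)) (trans (cong ∣_∣ (sym (∩-idem (facet C i)))) e)))
  ; adj?     = λ i j → ∣ facet C i ∩ facet C j ∣ ℕ.≟ k ℕ.∸ 1
  }

infixr 8 _•_

_•_ : ∀ {n k h} → Permutation′ h → Conf n k h → Conf n k h
σ • C = record
  { facet    = λ i → facet C (σ ⟨$⟩ˡ i)
  ; size     = λ i → size C (σ ⟨$⟩ˡ i)
  ; distinct = Injection.injective (↔⇒↣ (flip σ)) ∘ distinct C
  }

∂ᴰ : ∀ {n k m} .{{_ : NonZero k}} → Conf n k (ℕ.suc m) → Conf n k (ℕ.suc m)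
∂ᴰ C = ∂ (dualGraph C) • C

module Submission where

-- The promotion never reverses an edge of the dual graph: if a < b are adjacent, then
-- ∂ a < ∂ b.  Any rearrangement with this property preserves shellings.  Say i comes
-- before j in the new order.  If i < j, the old witness z for (i , j) is adjacent to j
-- and so still precedes it.  If j < i, take the old witness z for (j , i): it satisfies
-- C i ∩ C j ⊆ C z and comes before i, hence before j, in the new order, so the pair
-- (z , j) may replace (i , j), and z < i makes this terminate.

open import Defs
open import Data.Nat.Base using (ℕ; suc; NonZero; _≤_)
import Data.Nat.Base as ℕ
import Data.Nat.Properties as ℕ
open import Data.Fin.Base using (Fin; zero; suc; toℕ; pred; _<_)
import Data.Fin.Base as Fin
open import Data.Fin.Induction using (<-wellFounded)
open import Data.Fin.Permutation using (Permutation′; _⟨$⟩ʳ_; _⟨$⟩ˡ_; inverseˡ; inverseʳ)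
open import Data.Fin.Properties using (<-cmp; toℕ-inject₁; toℕ-injective; toℕ≤pred[n]; toℕ-fromℕ)
open import Data.Fin.Subset using (_∩_; _⊆_)
open import Data.Fin.Subset.Properties using (x∈p∩q⁺; x∈p∩q⁻)
open import Data.Product.Base using (∃; ∃-syntax; _×_; _,_; proj₁; proj₂)
open import Induction.WellFounded using (Acc; acc)
open import Relation.Binary.Definitions using (tri<; tri≈; tri>)
open import Relation.Binary.PropositionalEquality using (_≡_; _≢_; refl; sym; subst; subst₂)
open import Relation.Nullary using (¬_; contradiction)

toℕ-pred : ∀ {n} (i : Fin n) → toℕ (pred i) ≡ ℕ.pred (toℕ i)
toℕ-pred zero    = refl
toℕ-pred (suc i) = toℕ-inject₁ i

pred-mono-< : ∀ {n} {i j : Fin (suc n)} → i ≢ zero → i < j → pred i < pred j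
pred-mono-< {i = zero}              i≢0 _   = contradiction refl i≢0
pred-mono-< {i = suc i} {j = suc j} _   i<j =
  subst₂ ℕ._<_ (sym (toℕ-inject₁ i)) (sym (toℕ-inject₁ j)) (ℕ.s<s⁻¹ i<j)

module _ {m : ℕ} (G : Graph (suc m)) where
  open Graph G
  open Promotion G hiding (∂)

  -- A track vertex goes just before a later vertex or to the end, so the drop by one off the track
  -- is the worst case.
  pred≤promotes : ∀ {i p} → Promotes i p → pred i Fin.≤ p
  pred≤promotes (off _ refl) = ℕ.≤-refl
  pred≤promotes {i} (move {j} _ (i<j , _) refl)
    rewrite toℕ-pred i | toℕ-pred j = ℕ.pred-mono-≤ (ℕ.<⇒≤ i<j)
  pred≤promotes {i} (end _ _ refl)
    rewrite toℕ-fromℕ m = toℕ≤pred[n] (pred i)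

  -- Serves edges whose later endpoint is the next track vertex. Zero is excluded since promotion
  -- may fix it and `pred zero` is `zero`.
  pred<promotes : ∀ {i p} → InTrack i → i ≢ zero → Promotes i p → pred i < p
  pred<promotes t _   (off ¬t _)              = contradiction t ¬t
  pred<promotes _ i≢0 (move _ (i<j , _) refl) = pred-mono-< i≢0 i<j
  pred<promotes _ i≢0 P@(end _ _ refl)        =
    ℕ.≤∧≢⇒< (pred≤promotes P) (λ eq → pred≢last i≢0 (toℕ-injective eq))

  -- Descent on `j`: induction excludes smaller later neighbours of `i`, so `j` would be the least
  -- one, giving `Next i j`.
  no-next⇒no-later-neighbour : ∀ {i j} → ¬ ∃ (Next i) → Acc _<_ j → i < j → ¬ Adj i j
  no-next⇒no-later-neighbour ¬nx (acc rs) i<j a =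
    ¬nx (_ , i<j , a , λ l i<l b →
      ℕ.≮⇒≥ (λ l<j → no-next⇒no-later-neighbour ¬nx (rs l<j) i<l b))

  -- Off the track, `i` drops by exactly one and `j` by at most one. On it, the later neighbour `j`
  -- forces a next vertex `j′ ≤ j`, and `i` lands at `pred j′`.
  promotes-mono-adj : ∀ {i j p q} → Promotes i p → Promotes j q → i < j → Adj i j → p < q
  promotes-mono-adj (off ¬t refl) Q i<j _ =
    ℕ.<-≤-trans (pred-mono-< (off≢0 ¬t) i<j) (pred≤promotes Q)
  promotes-mono-adj {j = j} (move {j′} t nx@(_ , _ , least) refl) Q i<j a with <-cmp j′ j
  ... | tri< j′<j _ _ = ℕ.<-≤-trans (pred-mono-< (next≢0 nx) j′<j) (pred≤promotes Q)
  -- Here `p` is `pred j` itself, so the strict bound for the track vertex `j` is required.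
  ... | tri≈ _ refl _ = pred<promotes (step t nx) (next≢0 nx) Q
  ... | tri> _ _ j<j′ = contradiction (least j i<j a) (ℕ.<⇒≱ j<j′)
  promotes-mono-adj (end _ ¬nx _) _ i<j a =
    contradiction a (no-next⇒no-later-neighbour ¬nx (<-wellFounded _) i<j)

  ∂-mono-adj : ∀ {i j} → i < j → Adj i j → ∂ G ⟨$⟩ʳ i < ∂ G ⟨$⟩ʳ j
  ∂-mono-adj {i} {j} = promotes-mono-adj (proj₂ (promote i)) (proj₂ (promote j))

module _ {n k h : ℕ} .{{_ : NonZero k}} (C : Conf n k h) where
  open Graph (dualGraph C)

  module _ (σ : Permutation′ h)
           (σ-mono : ∀ {i j} → i < j → Adj i j → σ ⟨$⟩ʳ i < σ ⟨$⟩ʳ j)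
           (shelling : IsShellingOrder C) where

    witness : ∀ i j → Acc _<_ i → σ ⟨$⟩ʳ i < σ ⟨$⟩ʳ j →
      ∃[ z ] σ ⟨$⟩ʳ z < σ ⟨$⟩ʳ j × Adj z j × facet C i ∩ facet C j ⊆ facet C z ∩ facet C j
    witness i j (acc rs) σi<σj with <-cmp i j
    ... | tri< i<j _ _ =
      let z , z<j , adj , sub = shelling i j i<j in z , σ-mono z<j adj , adj , sub
    ... | tri≈ _ refl _ = contradiction σi<σj (ℕ.<-irrefl refl)
    ... | tri> _ _ j<i =
      let z , z<i , adj , sub = shelling j i j<i
          w , σw<σj , adj′ , sub′ = witness z j (rs z<i) (ℕ.<-trans (σ-mono z<i adj) σi<σj)
      in w , σw<σj , adj′ , λ x∈ →
        let x∈i , x∈j = x∈p∩q⁻ _ _ x∈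
            x∈z , _   = x∈p∩q⁻ _ _ (sub (x∈p∩q⁺ (x∈j , x∈i)))
        in sub′ (x∈p∩q⁺ (x∈z , x∈j))

    •-shelling : IsShellingOrder (σ • C)
    •-shelling p q p<q =
      let i = σ ⟨$⟩ˡ p
          j = σ ⟨$⟩ˡ q
          z , σz<σj , adj , sub = witness i j (<-wellFounded i)
            (subst₂ _<_ (sym (inverseʳ σ)) (sym (inverseʳ σ)) p<q)
      in σ ⟨$⟩ʳ z
       , subst (σ ⟨$⟩ʳ z <_) (inverseʳ σ) σz<σj
       -- The facet of `σ • C` at `σ ⟨$⟩ʳ z` is that of `z` only up to `inverseˡ`.
       , subst (λ y → Adj y j × facet C i ∩ facet C j ⊆ facet C y ∩ facet C j)
               (sym (inverseˡ σ)) (adj , sub)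

theorem5p4 : (k n : ℕ) .{{_ : NonZero k}} .{{_ : NonZero n}} → k ≤ n →
    (m : ℕ) (C : Conf n k (suc m)) → IsShellingOrder C → IsShellingOrder (∂ᴰ C)
theorem5p4 k n _ m C =
  •-shelling C (∂ (dualGraph C)) (∂-mono-adj (dualGraph C))
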